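{- Let $n,s,k \in \mathbb{Z}^+$ with $1 \leq s \leq n-2$ and $k \leq \binom{n}{2}$. If $\gcd(s,n) = 1$, then there is an $s$-overlap cycle for $\mathcal{W}_k(n)$.
   Context: $\mathcal{W}(n)$ denotes the set of weak orders on $[n]$ (transitive and complete relations), represented as words: $\mathcal{W}(n)$ is the set of all words $w_1w_2\ldots w_n$ of length $n$ over the nonnegative integers such that $\{w_1,\dots,w_n\} = \{0,1,\dots,h\}$ for some $h$ with $0 \le h \le n-1$ (here $w_j$ is the height of element $j$ in the weak order). The weight of $w = w_1\ldots w_n$ is $\sum_{i=1}^n w_i$, and $\mathcal{W}_k(n)$ is the set of $w \in \mathcal{W}(n)$ of weight $k$. An $s$-overlap cycle ($s$-ocycle) for a set of words of length $n$ is a cyclically ordered listing of the words in the set, each appearing exactly once, such that the last $s$ letters of each word are the first $s$ letters (in the same order) of its successor in the listing (the successor of the last word being the first word). -}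

module Defs where

open import Data.List.Base as List using (List; []; _∷_; _∷ʳ_)
import Data.List.Membership.Propositional as List
open import Data.List.Relation.Unary.Linked using (Linked)
open import Data.List.Relation.Unary.Unique.Propositional using (Unique)
open import Data.Nat.Base using (ℕ; _∸_; _≤_; _<_)
open import Data.Product.Base using (∃-syntax; _×_)
open import Data.Unit.Polymorphic.Base using (⊤)
open import Data.Vec.Base using (Vec; sum; toList)
open import Data.Vec.Membership.Propositional using (_∈_)
open import Function.Bundles using (_⇔_)
open import Level using (Level; _⊔_)
open import Relation.Binary.Core using (Rel)
open import Relation.Binary.PropositionalEquality.Core using (_≡_)
open import Relation.Unary using (Pred)

private
  variable
    a ℓ : Level
    A   : Set a
    n   : ℕ

-- A weak order on [n], as its word of heights: the set of letters of w is
-- exactly {0, 1, …, h}.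
IsWeakOrder : Vec ℕ n → Set
IsWeakOrder {n} w = ∃[ h ] h < n × (∀ x → x ∈ w ⇔ x ≤ h)

weight : Vec ℕ n → ℕ
weight = sum

-- 𝓦 k n is the set of weak orders on [n] of weight k.
𝓦 : (k n : ℕ) → Pred (Vec ℕ n) _
𝓦 k n w = IsWeakOrder w × weight w ≡ k

-- The last s letters of u are the first s letters of v.  Only meaningful for
-- s ≤ n: for larger s, both sides are whole words.
Overlap : ℕ → Rel (Vec A n) _
Overlap {n = n} s u v = List.drop (n ∸ s) (toList u) ≡ List.take s (toList v)

-- Each entry is related to the next one, and the last entry to the first
-- (a single entry is its own successor).
CyclicallyLinked : Rel A ℓ → Pred (List A) _
CyclicallyLinked R []       = ⊤
CyclicallyLinked R (x ∷ xs) = Linked R ((x ∷ xs) ∷ʳ x)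

record IsOverlapCycle {A : Set a} {n} (s : ℕ) (P : Pred (Vec A n) ℓ)
                      (ws : List (Vec A n)) : Set (a ⊔ ℓ) where
  field
    unique   : Unique ws
    lists    : ∀ w → w List.∈ ws ⇔ P w
    overlaps : CyclicallyLinked (Overlap s) ws

HasOverlapCycle : {A : Set a} {n : ℕ} → ℕ → Pred (Vec A n) ℓ → Set (a ⊔ ℓ)
HasOverlapCycle s P = ∃[ ws ] IsOverlapCycle s P ws

{-# OPTIONS --safe #-}
module Submission where

-- Moving the last s letters of a word to the front gives a possible successor,
-- so each orbit of this rotation is a cycle.  Words with the same last s letters
-- have the same possible successors, so disjoint cycles through two such words
-- can be merged by swapping these successors.  It remains to connect all words by
-- rotations and by changes of the first n - s ≥ 2 letters.  As gcd s n = 1, every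
-- rotation is available, hence every transposition of adjacent letters, hence
-- every permutation.  On multisets of letters, as long as the largest letter h is
-- at least 2 and there are two zeros, replace h, 0 by h - 1, 1.  This ends with
-- a word over {0, 1}, determined up to permutation by n and k, or with a single 0
-- and the successors of the letters of a weak order on n - 1 elements, where
-- induction applies.  If both ends occur for the same n and k, they are
-- permutations of each other.

open import Defs
open import Data.List.Base
  using (List; []; _∷_; _∷ʳ_; _++_; [_]; applyUpTo; cartesianProductWith; drop;
         filter; length; map; replicate; take; upTo)
open import Data.List.Properties
  using (++-assoc; ++-identityʳ; applyUpTo-∷ʳ; length-drop; length-map; length-take;
         map-++; take++drop≡id; ≡-dec)
open import Data.List.Membership.Propositional using (_∈_; _∉_)
open import Data.List.Membership.Propositional.Properties
  using (∈-∃++; ∈-++⁺ˡ; ∈-++⁺ʳ; ∈-++⁻; ∈-applyUpTo⁺; ∈-applyUpTo⁻; ∈-cartesianProductWith⁺;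
         ∈-filter⁺; ∈-filter⁻; ∈-map⁺; ∈-map⁻; ∈-upTo⁺)
import Data.List.Membership.DecPropositional as DecMembership
open import Data.List.Relation.Binary.Disjoint.Propositional using (Disjoint)
open import Data.List.Relation.Binary.Permutation.Propositional
  using (_↭_; refl; prep; swap; trans; ↭-sym; ↭-trans; ↭-reflexive; ↭⇒↭ₛ)
open import Data.List.Relation.Binary.Permutation.Propositional.Properties
  using (++-comm; ++⁺ˡ; map⁺; shift; ∈-resp-↭; ↭-length)
import Data.List.Relation.Binary.Permutation.Setoid.Properties as PermSetoid
open import Data.List.Relation.Binary.Subset.Propositional using (_⊆_)
open import Data.List.Relation.Unary.All as All using (All; []; _∷_)
import Data.List.Relation.Unary.All.Properties as All
open import Data.List.Relation.Unary.AllPairs using ([])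
open import Data.List.Relation.Unary.Any using (here; there)
open import Data.List.Relation.Unary.Linked as Linked using (Linked; [-]; _∷_)
import Data.List.Relation.Unary.Linked.Properties as Linked
open import Data.List.Relation.Unary.Unique.Propositional using (Unique)
import Data.List.Relation.Unary.Unique.Propositional.Properties as Unique
open import Data.Nat.Base
  using (ℕ; zero; suc; _+_; _*_; _∸_; _≤_; _<_; z≤n; s≤s; s≤s⁻¹)
open import Data.Nat.Combinatorics using (_C_)
open import Data.Nat.GCD using (gcd; gcd-GCD; GCD; module Bézout)
open import Data.Nat.GeneralisedArithmetic using (iterate)
open import Data.Nat.ListAction using (sum)
open import Data.Nat.ListAction.Properties using (sum-↭)
open import Data.Nat.Properties
open import Data.Nat.Tactic.RingSolver using (solve-∀)
open import Data.Product.Base using (∃-syntax; _×_; _,_; proj₁; proj₂)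
open import Data.Sum.Base using (_⊎_; inj₁; inj₂)
open import Data.Vec.Base as Vec using (Vec; fromList; toList)
open import Data.Vec.Membership.Propositional.Properties using (∈-toList⁺; ∈-toList⁻)
import Data.Vec.Properties as Vec
open import Function.Base using (_∘_)
open import Function.Bundles using (_⇔_; mk⇔; module Equivalence)
open import Level using (0ℓ)
open import Relation.Binary.Construct.Closure.ReflexiveTransitive
  using (Star; ε; _◅_; _◅◅_)
open import Relation.Binary.Core using (Rel)
open import Relation.Binary.Definitions using (DecidableEquality)
open import Relation.Binary.PropositionalEquality as ≡
  using (_≡_; _≢_; refl; sym; cong; cong₂; setoid; subst; subst₂; module ≡-Reasoning)
open import Relation.Nullary using (¬_; Dec; yes; no; contradiction; _×-dec_)
open import Relation.Nullary.Decidable using (map′)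
open import Relation.Unary using (Decidable; Pred)

open DecMembership _≟_ using (_∈?_)
open Equivalence using (to; from)

private
  variable
    A : Set

-- Iterates of a function and least witnesses.

iterate-+ : (f : A → A) (x : A) (m n : ℕ) →
            iterate f x (m + n) ≡ iterate f (iterate f x m) n
iterate-+ f x zero    n = refl
iterate-+ f x (suc m) n = iterate-+ f (f x) m n

iterate-* : (f : A → A) (m : ℕ) (x : A) (n : ℕ) →
            iterate (λ y → iterate f y m) x n ≡ iterate f x (n * m)
iterate-* f m x zero    = refl
iterate-* f m x (suc n) =
  ≡.trans (iterate-* f m (iterate f x m) n) (sym (iterate-+ f x m (n * m)))

iterate-suc : (f : A → A) (x : A) (n : ℕ) → f (iterate f x n) ≡ iterate f x (suc n)
iterate-suc f x zero    = refl
iterate-suc f x (suc n) = iterate-suc f (f x) n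

least : {Q : Pred ℕ 0ℓ} → Decidable Q → ∀ n → Q n →
        ∃[ d ] Q d × (∀ {j} → j < d → ¬ Q j)
least Q? zero    q = 0 , q , λ ()
least {Q} Q? (suc n) q with Q? 0
... | yes q₀ = 0 , q₀ , λ ()
... | no ¬q₀ with d , qd , min ← least (Q? ∘ suc) n q = suc d , qd , min′
  where
  min′ : ∀ {j} → j < suc d → ¬ Q j
  min′ {zero}  _         = ¬q₀
  min′ {suc j} (s≤s j<d) = min j<d

-- Linked lists and rotations of cyclic lists.

module _ {R : Rel A 0ℓ} where

  Linked-split : ∀ xs {v ys} → Linked R (xs ++ v ∷ ys) →
                 Linked R (xs ++ [ v ]) × Linked R (v ∷ ys)
  Linked-split []           l        = [-] , l
  Linked-split (x ∷ [])     (p ∷ l)  = p ∷ [-] , l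
  Linked-split (x ∷ y ∷ xs) (p ∷ l) with l₁ , l₂ ← Linked-split (y ∷ xs) l =
    p ∷ l₁ , l₂

  Linked-join : ∀ xs {v ys} → Linked R (xs ++ [ v ]) → Linked R (v ∷ ys) →
                Linked R (xs ++ v ∷ ys)
  Linked-join []           _       l = l
  Linked-join (x ∷ [])     (p ∷ _) l = p ∷ l
  Linked-join (x ∷ y ∷ xs) (p ∷ k) l = p ∷ Linked-join (y ∷ xs) k l

  -- Only the link leaving the head changes; this is what lets two words trade successors.
  Linked-replaceHead : ∀ {u v} → (∀ {x} → R u x → R v x) → ∀ xs {y} →
                       Linked R (u ∷ xs ∷ʳ y) → Linked R (v ∷ xs ∷ʳ y)
  Linked-replaceHead f []       (p ∷ l) = f p ∷ l
  Linked-replaceHead f (x ∷ xs) (p ∷ l) = f p ∷ l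

  CyclicallyLinked-rotate : ∀ xs {u ys} → CyclicallyLinked R (xs ++ u ∷ ys) →
                            CyclicallyLinked R (u ∷ ys ++ xs)
  CyclicallyLinked-rotate []       {u} {ys} c =
    subst (CyclicallyLinked R) (sym (++-identityʳ (u ∷ ys))) c
  CyclicallyLinked-rotate (x ∷ xs) {u} {ys} c
    with l₁ , l₂ ← Linked-split (x ∷ xs)
           (subst (Linked R) (++-assoc (x ∷ xs) (u ∷ ys) [ x ]) c) =
    subst (Linked R) (sym (++-assoc (u ∷ ys) (x ∷ xs) [ u ]))
      (Linked-join (u ∷ ys) l₂ l₁)

Unique-resp-↭ : {xs ys : List A} → xs ↭ ys → Unique xs → Unique ys
Unique-resp-↭ {A} p = PermSetoid.Unique-resp-↭ (setoid A) (↭⇒↭ₛ p)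

-- Merging cycles.

-- Stands for words with r the rotation moving the last s letters to the front,
-- and with pre and suf the first and the last s letters.
module Gluing
  {B : Set} (_≟ᴬ_ : DecidableEquality A) (P : Pred A 0ℓ)
  (r : A → A) (P-r : ∀ {w} → P w → P (r w))
  (N : ℕ) (r-periodic : ∀ {w} → P w → iterate r w (suc N) ≡ w)
  (pre suf : A → B) (suf≡pre∘r : ∀ {w} → P w → suf w ≡ pre (r w))
  where

  open DecMembership _≟ᴬ_ using () renaming (_∈?_ to _∈ᴬ?_)

  R : Rel A 0ℓ
  R u v = suf u ≡ pre v

  data Step (u : A) : A → Set where
    rotate   : Step u (r u)
    exchange : ∀ {v} → P v → suf u ≡ suf v → Step u v

  -- A union of whole orbits of `r`, so that an orbit starting outside it is disjoint from it.
  record Closed (ws : List A) : Set where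
    field
      unique : Unique ws
      sound  : ∀ {w} → w ∈ ws → P w
      closed : ∀ {w} → w ∈ ws → r w ∈ ws

    closed-iterate : ∀ i {w} → w ∈ ws → iterate r w i ∈ ws
    closed-iterate zero    w∈ = w∈
    closed-iterate (suc i) w∈ = closed-iterate i (closed w∈)

  Cycle : List A → Set
  Cycle ws = Closed ws × CyclicallyLinked R ws

  Closed-resp-↭ : ∀ {xs ys} → xs ↭ ys → Closed xs → Closed ys
  Closed-resp-↭ p c = record
    { unique = Unique-resp-↭ p unique
    ; sound  = sound ∘ ∈-resp-↭ (↭-sym p)
    ; closed = ∈-resp-↭ p ∘ closed ∘ ∈-resp-↭ (↭-sym p)
    } where open Closed c

  Closed-++ : ∀ {xs ys} → Disjoint xs ys → Closed xs → Closed ys → Closed (xs ++ ys)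
  Closed-++ {xs} {ys} disj c d = record
    { unique = Unique.++⁺ (C.unique) (D.unique) disj
    ; sound  = λ w∈ → sound (∈-++⁻ xs w∈)
    ; closed = λ w∈ → closed (∈-++⁻ xs w∈)
    } where
    module C = Closed c
    module D = Closed d
    sound : ∀ {w} → w ∈ xs ⊎ w ∈ ys → P w
    sound (inj₁ w∈) = C.sound w∈
    sound (inj₂ w∈) = D.sound w∈
    closed : ∀ {w} → w ∈ xs ⊎ w ∈ ys → r w ∈ xs ++ ys
    closed (inj₁ w∈) = ∈-++⁺ˡ (C.closed w∈)
    closed (inj₂ w∈) = ∈-++⁺ʳ xs (D.closed w∈)

  P-iterate : ∀ i {w} → P w → P (iterate r w i)
  P-iterate zero    p = p
  P-iterate (suc i) p = P-iterate i (P-r p)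

  -- On `P`, `N` further iterations undo `r`.
  r-injective : ∀ {u v} → P u → P v → r u ≡ r v → u ≡ v
  r-injective p q eq =
    ≡.trans (sym (r-periodic p)) (≡.trans (cong (λ w → iterate r w N) eq) (r-periodic q))

  iterate-injective : ∀ i {u v} → P u → P v → iterate r u i ≡ iterate r v i → u ≡ v
  iterate-injective zero    p q eq = eq
  iterate-injective (suc i) p q eq =
    r-injective p q (iterate-injective i (P-r p) (P-r q) eq)

  -- The list runs through the iterates of `r` up to the first return to `v`, so nothing repeats. A
  -- closed list meeting it would contain `v`: iterate `r` from the common element until the return.
  orbit : ∀ {v} → P v → ∃[ ys ] Cycle (v ∷ ys) ×
          (∀ {ws} → Closed ws → v ∉ ws → Disjoint ws (v ∷ ys))
  orbit {v} p
    -- The period is `suc d`. Counting from one step excludes the trivial return after none, and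
    -- periodicity supplies the witness `N`.
    with d , period , minimal ← least (λ d → iterate r v (suc d) ≟ᴬ v) N (r-periodic p) =
    applyUpTo (f ∘ suc) d , (closed-orbit , linked) , disjoint
    where
    f : ℕ → A
    f = iterate r v

    distinct : ∀ {i j} → i < j → j < suc d → f i ≢ f j
    -- As `j ≡ suc e + i`, cancelling `i` iterations leaves a return after `suc e` steps, before the
    -- period is over.
    distinct {i} {j} i<j (s≤s j≤d) eq = minimal e<d
      (sym (iterate-injective i p (P-iterate (suc e) p)
        (≡.trans eq (≡.trans (cong f j≡) (iterate-+ r v (suc e) i)))))
      where
      e : ℕ
      e = j ∸ suc i
      j≡ : j ≡ suc e + i
      j≡ = ≡.trans (sym (m∸n+n≡m i<j)) (+-suc e i)
      e<d : e < d
      e<d = ≤-trans (subst (suc e ≤_) (sym j≡) (m≤m+n (suc e) i)) j≤d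

    closed : ∀ {w} → w ∈ applyUpTo f (suc d) → r w ∈ applyUpTo f (suc d)
    closed w∈ with i , i<1+d , refl ← ∈-applyUpTo⁻ f w∈
              with suc i ≟ suc d
    ... | yes refl = here (≡.trans (iterate-suc r v i) period)
    ... | no i≢d   = subst (_∈ applyUpTo f (suc d)) (sym (iterate-suc r v i))
                       (∈-applyUpTo⁺ f (≤∧≢⇒< i<1+d i≢d))

    closed-orbit : Closed (applyUpTo f (suc d))
    closed-orbit = record
      { unique = Unique.applyUpTo⁺₁ f (suc d) distinct
      ; sound  = λ w∈ → let i , _ , eq = ∈-applyUpTo⁻ f w∈ in
                        subst P (sym eq) (P-iterate i p)
      ; closed = closed
      }

    linked : Linked R (applyUpTo f (suc d) ∷ʳ v)
    linked = subst (λ x → Linked R (applyUpTo f (suc d) ∷ʳ x)) period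
      (subst (Linked R) (sym (applyUpTo-∷ʳ f (suc d)))
        (Linked.applyUpTo⁺₂ f (suc (suc d)) λ i →
          ≡.trans (suf≡pre∘r (P-iterate i p)) (cong pre (iterate-suc r v i))))

    disjoint : ∀ {ws} → Closed ws → v ∉ ws → Disjoint ws (applyUpTo f (suc d))
    disjoint {ws} c v∉ (w∈ws , w∈) with i , i<1+d , refl ← ∈-applyUpTo⁻ f w∈ =
      v∉ (subst (_∈ ws)
        (≡.trans (sym (iterate-+ r v i (suc d ∸ i)))
          (≡.trans (cong f (m+[n∸m]≡n (<⇒≤ i<1+d))) period))
        (Closed.closed-iterate c (suc d ∸ i) w∈ws))

  -- From `u` the merged cycle follows the former successors of `v` through `ys` back to `v`, then
  -- those of `u` through `xs` back to `u`. The changed links are valid because a link depends only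
  -- on `suf` of its source.
  merge : ∀ {u v xs ys} → suf u ≡ suf v → Disjoint (u ∷ xs) (v ∷ ys) →
          Cycle (u ∷ xs) → Cycle (v ∷ ys) →
          ∃[ ws ] Cycle ws × ws ↭ (u ∷ xs) ++ (v ∷ ys)
  merge {u} {v} {xs} {ys} eq disj (c , k) (d , l) =
    u ∷ ys ++ v ∷ xs , (Closed-resp-↭ (↭-sym perm) (Closed-++ disj c d) , linked) , perm
    where
    perm : u ∷ ys ++ v ∷ xs ↭ (u ∷ xs) ++ (v ∷ ys)
    perm = prep u (↭-trans (shift v ys xs)
      (↭-trans (prep v (++-comm ys xs)) (↭-sym (shift v xs ys))))
    linked : Linked R (u ∷ (ys ++ v ∷ xs) ∷ʳ u)
    linked = subst (Linked R) (sym (++-assoc (u ∷ ys) (v ∷ xs) [ u ]))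
      (Linked-join (u ∷ ys)
        (Linked-replaceHead (≡.trans eq) ys l)
        (Linked-replaceHead (≡.trans (sym eq)) xs k))

  Extension : List A → A → Set
  Extension ws v = ∃[ ws′ ] Cycle ws′ × ws ⊆ ws′ × v ∈ ws′

  -- If `v` is missing, so is its whole orbit; rotating the cycle to put `u` first allows the two to
  -- be merged.
  absorb : ∀ {ws u v} → Cycle ws → u ∈ ws → P v → suf u ≡ suf v → Extension ws v
  absorb {ws} {u} {v} (c , k) u∈ q eq with v ∈ᴬ? ws
  ... | yes v∈ = ws , (c , k) , (λ w∈ → w∈) , v∈
  ... | no v∉
    with xs , xs′ , refl ← ∈-∃++ u∈
    with ys , cyc , disj ← orbit q
    with rot ← ++-comm xs (u ∷ xs′)
    with c′ ← Closed-resp-↭ rot c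
    with ws′ , cyc′ , perm ← merge eq
           (disj c′ (v∉ ∘ ∈-resp-↭ (↭-sym rot))) (c′ , CyclicallyLinked-rotate xs k) cyc
    = ws′ , cyc′ , ∈-resp-↭ (↭-sym perm) ∘ ∈-++⁺ˡ ∘ ∈-resp-↭ rot
    , ∈-resp-↭ (↭-sym perm) (∈-++⁺ʳ (u ∷ xs′ ++ xs) (here refl))

  -- Rotations stay inside the cycle, which is closed under `r`; only exchanges can bring in a new
  -- orbit.
  extend : ∀ {ws u v} → Cycle ws → u ∈ ws → Star Step u v → Extension ws v
  extend {ws} c u∈ ε                      = ws , c , (λ w∈ → w∈) , u∈
  extend      c u∈ (rotate ◅ path)        = extend c (Closed.closed (proj₁ c) u∈) path
  extend      c u∈ (exchange q eq ◅ path)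
    with ws₁ , c₁ , ⊆₁ , v∈ ← absorb c u∈ q eq
    with ws₂ , c₂ , ⊆₂ , w∈ ← extend c₁ v∈ path
    = ws₂ , c₂ , ⊆₂ ∘ ⊆₁ , w∈

  extendAll : ∀ {ws u} → Cycle ws → u ∈ ws → ∀ vs → (∀ {v} → v ∈ vs → Star Step u v) →
              ∃[ ws′ ] Cycle ws′ × ws ⊆ ws′ × vs ⊆ ws′
  extendAll {ws} c u∈ []       _     = ws , c , (λ w∈ → w∈) , λ ()
  extendAll      c u∈ (v ∷ vs) paths
    with ws₁ , c₁ , ⊆₁ , v∈ ← extend c u∈ (paths (here refl))
    with ws₂ , c₂ , ⊆₂ , vs⊆ ← extendAll c₁ (⊆₁ u∈) vs (paths ∘ there)
    = ws₂ , c₂ , ⊆₂ ∘ ⊆₁ , λ { (here refl) → ⊆₂ v∈ ; (there w∈) → vs⊆ w∈ }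

  coveringCycle : ∀ vs → (∀ {v} → v ∈ vs → P v) →
                  (∀ {u v} → P u → P v → Star Step u v) →
                  ∃[ ws ] Cycle ws × vs ⊆ ws
  coveringCycle []       _     _         =
    [] , (record { unique = [] ; sound = λ () ; closed = λ () } , _) , λ ()
  coveringCycle (v ∷ vs) sound connected
    with ys , c , _ ← orbit (sound (here refl))
    with ws , c′ , ⊆ws , vs⊆ ← extendAll c (here refl) vs
           (λ w∈ → connected (sound (here refl)) (sound (there w∈)))
    = ws , c′ , λ { (here refl) → ⊆ws (here refl) ; (there w∈) → vs⊆ w∈ }

-- Weak orders and weight-preserving changes of words.

LettersUpTo : ℕ → List ℕ → Set
LettersUpTo h w = ∀ x → x ∈ w ⇔ x ≤ h

WeakOrder : List ℕ → Set
WeakOrder w = ∃[ h ] h < length w × LettersUpTo h w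

LettersUpTo-resp-↭ : ∀ {h v w} → v ↭ w → LettersUpTo h v → LettersUpTo h w
LettersUpTo-resp-↭ p letters x =
  mk⇔ (to (letters x) ∘ ∈-resp-↭ (↭-sym p)) (∈-resp-↭ p ∘ from (letters x))

WeakOrder-resp-↭ : ∀ {v w} → v ↭ w → WeakOrder v → WeakOrder w
WeakOrder-resp-↭ p (h , h< , letters) =
  h , subst (h <_) (↭-length p) h< , LettersUpTo-resp-↭ p letters

infix 3 _≈_
-- Connectivity of words, stated independently of s. Changing two letters at the front is enough,
-- since permutations bring any two letters there.
data _≈_ : List ℕ → List ℕ → Set where
  permute  : ∀ {v w} → v ↭ w → v ≈ w
  exchange : ∀ {x y x′ y′ t} → WeakOrder (x ∷ y ∷ t) → WeakOrder (x′ ∷ y′ ∷ t) →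
             x + y ≡ x′ + y′ → x ∷ y ∷ t ≈ x′ ∷ y′ ∷ t
  ≈-trans  : ∀ {u v w} → u ≈ v → v ≈ w → u ≈ w

≈-sym : ∀ {v w} → v ≈ w → w ≈ v
≈-sym (permute p)       = permute (↭-sym p)
≈-sym (exchange p q eq) = exchange q p (sym eq)
≈-sym (≈-trans p q)     = ≈-trans (≈-sym q) (≈-sym p)

≈-length : ∀ {v w} → v ≈ w → length v ≡ length w
≈-length (permute p)      = ↭-length p
≈-length (exchange _ _ _) = refl
≈-length (≈-trans p q)    = ≡.trans (≈-length p) (≈-length q)

≈-sum : ∀ {v w} → v ≈ w → sum v ≡ sum w
≈-sum (permute p) = sum-↭ p
≈-sum (exchange {x} {y} {x′} {y′} {t} _ _ eq) =
  ≡.trans (sym (+-assoc x y (sum t)))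
    (≡.trans (cong (_+ sum t) eq) (+-assoc x′ y′ (sum t)))
≈-sum (≈-trans p q) = ≡.trans (≈-sum p) (≈-sum q)

WeakOrder-resp-≈ : ∀ {v w} → v ≈ w → WeakOrder v → WeakOrder w
WeakOrder-resp-≈ (permute p)      = WeakOrder-resp-↭ p
WeakOrder-resp-≈ (exchange _ q _) = λ _ → q
WeakOrder-resp-≈ (≈-trans p q)    = WeakOrder-resp-≈ q ∘ WeakOrder-resp-≈ p

-- Puts one new element strictly below all others, the inverse of deleting a unique minimum.
lift : List ℕ → List ℕ
lift w = 0 ∷ map suc w

suc-∈-lift⁻ : ∀ {x w} → suc x ∈ lift w → x ∈ w
suc-∈-lift⁻ (there x∈) with _ , y∈ , refl ← ∈-map⁻ suc x∈ = y∈

LettersUpTo-lift⁺ : ∀ {h w} → LettersUpTo h w → LettersUpTo (suc h) (lift w)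
LettersUpTo-lift⁺ letters zero    = mk⇔ (λ _ → z≤n) (λ _ → here refl)
LettersUpTo-lift⁺ letters (suc x) = mk⇔
  (s≤s ∘ to (letters x) ∘ suc-∈-lift⁻)
  (λ { (s≤s x≤h) → there (∈-map⁺ suc (from (letters x) x≤h)) })

LettersUpTo-lift⁻ : ∀ {h w} → LettersUpTo (suc h) (lift w) → LettersUpTo h w
LettersUpTo-lift⁻ letters x = mk⇔
  (λ x∈ → s≤s⁻¹ (to (letters (suc x)) (there (∈-map⁺ suc x∈))))
  (suc-∈-lift⁻ ∘ from (letters (suc x)) ∘ s≤s)

WeakOrder-lift : ∀ {w} → WeakOrder w → WeakOrder (lift w)
WeakOrder-lift {w} (h , h< , letters) =
  suc h , s≤s (subst (h <_) (sym (length-map suc w)) h<) , LettersUpTo-lift⁺ letters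

-- An exchange acts on the first two letters, so the new zero is first moved behind them.
lift-≈ : ∀ {v w} → v ≈ w → lift v ≈ lift w
lift-≈ (permute p) = permute (prep 0 (map⁺ suc p))
lift-≈ (exchange {x} {y} {x′} {y′} {t} p q eq) =
  ≈-trans (permute (outward x y))
    (≈-trans
      (exchange (WeakOrder-resp-↭ (outward x y) (WeakOrder-lift p))
                (WeakOrder-resp-↭ (outward x′ y′) (WeakOrder-lift q))
                (cong suc (≡.trans (+-suc x y) (≡.trans (cong suc eq) (sym (+-suc x′ y′))))))
      (permute (↭-sym (outward x′ y′))))
  where
  outward : ∀ x y → lift (x ∷ y ∷ t) ↭ suc x ∷ suc y ∷ lift t
  outward x y = ↭-trans (swap 0 (suc x) refl) (prep (suc x) (swap 0 (suc y) refl))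
lift-≈ (≈-trans p q) = ≈-trans (lift-≈ p) (lift-≈ q)

sum-map-suc : ∀ w → sum (map suc w) ≡ length w + sum w
sum-map-suc []      = refl
sum-map-suc (x ∷ w) = cong suc (begin
  x + sum (map suc w)      ≡⟨ cong (x +_) (sum-map-suc w) ⟩
  x + (length w + sum w)   ≡⟨ +-assoc x (length w) (sum w) ⟨
  x + length w + sum w     ≡⟨ cong (_+ sum w) (+-comm x (length w)) ⟩
  length w + x + sum w     ≡⟨ +-assoc (length w) x (sum w) ⟩
  length w + (x + sum w)   ∎)
  where open ≡-Reasoning

all≤sum : ∀ w → All (_≤ sum w) w
all≤sum []      = []
all≤sum (x ∷ w) =
  m≤m+n x (sum w) ∷ All.map (λ y≤ → ≤-trans y≤ (m≤n+m (sum w) x)) (all≤sum w)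

-- Binary words.

Binary : List ℕ → Set
Binary = All (_≤ 1)

binary-sum≤length : ∀ {w} → Binary w → sum w ≤ length w
binary-sum≤length []       = z≤n
binary-sum≤length (p ∷ ps) = +-mono-≤ p (binary-sum≤length ps)

binary-sum<length : ∀ {w} → Binary w → 0 ∈ w → sum w < length w
binary-sum<length (_ ∷ ps) (here refl) = s≤s (binary-sum≤length ps)
binary-sum<length {x ∷ w} (p ∷ ps) (there 0∈) =
  subst (_≤ suc (length w)) (+-suc x (sum w)) (+-mono-≤ p (binary-sum<length ps 0∈))

binary-sort : ∀ {w} → Binary w →
              ∃[ b ] length w ≡ sum w + b × w ↭ replicate (sum w) 1 ++ replicate b 0
binary-sort [] = 0 , refl , refl
binary-sort {0 ∷ w} (_ ∷ ps) with b , eq , p ← binary-sort ps =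
  suc b , ≡.trans (cong suc eq) (sym (+-suc (sum w) b)) ,
  ↭-trans (prep 0 p) (↭-sym (shift 0 (replicate (sum w) 1) (replicate b 0)))
binary-sort {1 ∷ w} (_ ∷ ps) with b , eq , p ← binary-sort ps =
  b , cong suc eq , prep 1 p
binary-sort {suc (suc _) ∷ _} (s≤s () ∷ _)

-- The sum counts the ones, and the rest of the length counts the zeros.
binary-↭ : ∀ {v w} → Binary v → Binary w → length v ≡ length w → sum v ≡ sum w → v ↭ w
binary-↭ {v} {w} p q len eq
  with b , eq₁ , p₁ ← binary-sort p
     | c , eq₂ , p₂ ← binary-sort q =
  ↭-trans p₁ (↭-trans (↭-reflexive (cong₂ (λ m n → replicate m 1 ++ replicate n 0) eq b≡c))
    (↭-sym p₂))
  where
  b≡c : b ≡ c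
  b≡c = +-cancelˡ-≡ (sum w) b c
    (≡.trans (cong (_+ b) (sym eq)) (≡.trans (sym eq₁) (≡.trans len eq₂)))

-- Reduction of weak orders of fixed length and weight.

data Reduced : List ℕ → Set where
  binary : ∀ {w} → Binary w → Reduced w
  lifted : ∀ u → WeakOrder u → Reduced (lift u)

separateZeros : ∀ w → ∃[ z ] ∃[ u ] w ↭ replicate z 0 ++ map suc u
separateZeros [] = 0 , [] , refl
separateZeros (0 ∷ w) with z , u , p ← separateZeros w = suc z , u , prep 0 p
separateZeros (suc x ∷ w) with z , u , p ← separateZeros w =
  z , x ∷ u , ↭-trans (prep (suc x) p) (↭-sym (shift (suc x) (replicate z 0) (map suc u)))

LettersUpTo⇒All : ∀ {h w} → LettersUpTo h w → All (_≤ h) w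
LettersUpTo⇒All letters = All.tabulate λ {x} → to (letters x)

-- The lost 0 survives in `t`. If the lost top letter survives there too, the same letters occur;
-- otherwise exactly the top letter disappears and `suc h` becomes the largest.
WeakOrder-lowerTop : ∀ {h t} → 0 ∈ t → suc (suc h) < length (suc (suc h) ∷ 0 ∷ t) →
                     LettersUpTo (suc (suc h)) (suc (suc h) ∷ 0 ∷ t) →
                     WeakOrder (suc h ∷ 1 ∷ t)
WeakOrder-lowerTop {h} {t} 0∈t H< letters with suc (suc h) ∈? t
... | yes H∈t = suc (suc h) , H< , λ x → mk⇔ (bounded x) (present x)
  where
  bounded : ∀ x → x ∈ suc h ∷ 1 ∷ t → x ≤ suc (suc h)
  bounded _ (here refl)         = n≤1+n (suc h)
  bounded _ (there (here refl)) = s≤s z≤n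
  bounded x (there (there x∈t)) = to (letters x) (there (there x∈t))
  present : ∀ x → x ≤ suc (suc h) → x ∈ suc h ∷ 1 ∷ t
  present x x≤ with from (letters x) x≤
  ... | here refl         = there (there H∈t)
  ... | there (here refl) = there (there 0∈t)
  ... | there (there x∈t) = there (there x∈t)
... | no H∉t = suc h , <-trans (n<1+n (suc h)) H< , λ x → mk⇔ (bounded x) (present x)
  where
  bounded : ∀ x → x ∈ suc h ∷ 1 ∷ t → x ≤ suc h
  bounded _ (here refl)         = ≤-refl
  bounded _ (there (here refl)) = s≤s z≤n
  bounded x (there (there x∈t)) =
    s≤s⁻¹ (≤∧≢⇒< (to (letters x) (there (there x∈t))) λ { refl → H∉t x∈t })
  present : ∀ x → x ≤ suc h → x ∈ suc h ∷ 1 ∷ t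
  present x x≤ with from (letters x) (m≤n⇒m≤1+n x≤)
  ... | here refl         = contradiction x≤ (<⇒≱ (n<1+n (suc h)))
  ... | there (here refl) = there (there 0∈t)
  ... | there (there x∈t) = there (there x∈t)

-- Each lowering of the top letter turns a zero into a 1, so the recursion is on the number of
-- zeros. It stops when the top letter is at most 1 or a single zero is left.
reduce : ∀ z u → WeakOrder (replicate (suc z) 0 ++ map suc u) →
         ∃[ v ] (replicate (suc z) 0 ++ map suc u ≈ v) × Reduced v
reduce z u (0 , _ , letters) =
  _ , permute refl , binary (All.map (λ x≤0 → ≤-trans x≤0 z≤n) (LettersUpTo⇒All letters))
reduce z u (1 , _ , letters) = _ , permute refl , binary (LettersUpTo⇒All letters)
-- With a single zero the word is `lift u` by computation.
reduce zero u (suc (suc h) , s≤s h< , letters) =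
  lift u , permute refl ,
  lifted u (suc h , subst (suc h <_) (length-map suc u) h< , LettersUpTo-lift⁻ letters)
reduce (suc z) u wo@(suc (suc h) , _ , letters)
  with ∈-++⁻ (replicate (suc (suc z)) 0) (from (letters (suc (suc h))) ≤-refl)
... | inj₁ H∈0s with () ← All.lookup (All.replicate⁺ {P = _≡ 0} (suc (suc z)) refl) H∈0s
... | inj₂ H∈u with _ , h∈ , refl ← ∈-map⁻ suc H∈u
  with xs , ys , refl ← ∈-∃++ h∈ =
  -- `u` holds predecessors, so the new letters `suc h` and 1 enter it as `h` and 0.
  let v , q , red = reduce z (h ∷ 0 ∷ t) (WeakOrder-resp-↭ insert after)
  in v
   , ≈-trans (permute extract) (≈-trans (exchange before after eq) (≈-trans (permute insert) q))
   , red
  where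
  t rest : List ℕ
  t    = xs ++ ys
  rest = replicate (suc z) 0 ++ map suc t
  extract : replicate (suc (suc z)) 0 ++ map suc (xs ++ [ suc h ] ++ ys) ↭ suc (suc h) ∷ 0 ∷ rest
  extract = ↭-trans (++⁺ˡ (replicate (suc (suc z)) 0) (map⁺ suc (shift (suc h) xs ys)))
                    (shift (suc (suc h)) (replicate (suc (suc z)) 0) (map suc t))
  insert : suc h ∷ 1 ∷ rest ↭ replicate (suc z) 0 ++ map suc (h ∷ 0 ∷ t)
  insert = ↭-sym (↭-trans (shift (suc h) (replicate (suc z) 0) (1 ∷ map suc t))
                           (prep (suc h) (shift 1 (replicate (suc z) 0) (map suc t))))
  before : WeakOrder (suc (suc h) ∷ 0 ∷ rest)
  before = WeakOrder-resp-↭ extract wo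
  after : WeakOrder (suc h ∷ 1 ∷ rest)
  after = WeakOrder-lowerTop (here refl) (proj₁ (proj₂ before)) (proj₂ (proj₂ before))
  eq : suc (suc h) + 0 ≡ suc h + 1
  eq = cong suc (≡.trans (cong suc (+-identityʳ h)) (+-comm 1 h))

reducible : ∀ {w} → WeakOrder w → ∃[ v ] (w ≈ v) × Reduced v
reducible {w} wo@(_ , _ , letters) with separateZeros w
... | zero  , u , p
  with () ← proj₂ (proj₂ (∈-map⁻ suc (∈-resp-↭ p (from (letters 0) z≤n))))
... | suc z , u , p with v , q , red ← reduce z u (WeakOrder-resp-↭ p wo) =
  v , ≈-trans (permute p) q , red

-- A binary word containing 0 has sum below its length, whereas the sum of `lift u` is
-- `length u + sum u` and its length `suc (length u)`. Hence `sum u` is 0 and `lift u` is binary as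
-- well.
binary-lifted-≈ : ∀ {v u} → Binary v → 0 ∈ v → length v ≡ length (lift u) →
                  sum v ≡ sum (lift u) → v ≈ lift u
binary-lifted-≈ {v} {u} p 0∈ len eq = permute (binary-↭ p q len eq)
  where
  sum<1 : sum u < 1
  sum<1 = +-cancelˡ-< (length u) (sum u) 1
    (subst₂ _<_ (≡.trans eq (sum-map-suc u))
       (≡.trans len (≡.trans (cong suc (length-map suc u)) (+-comm 1 (length u))))
       (binary-sum<length p 0∈))
  q : Binary (lift u)
  q = z≤n ∷ All.map⁺ (All.map (λ x≤ → ≤-<-trans x≤ sum<1) (all≤sum u))

WeakOrder⇒0∈ : ∀ {w} → WeakOrder w → 0 ∈ w
WeakOrder⇒0∈ (_ , _ , letters) = from (letters 0) z≤n

-- Both words reduce. The induction on length serves the case of two lifted words: deleting the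
-- unique zero and decreasing the other letters lowers both weights by `n`.
equalWeight⇒≈ : ∀ n {v w} → length v ≡ n → length w ≡ n → WeakOrder v → WeakOrder w →
                sum v ≡ sum w → v ≈ w
equalWeight⇒≈ zero {v = []} _ _ (_ , () , _) _ _
equalWeight⇒≈ (suc n) {v} {w} ∣v∣ ∣w∣ p q eq
  with v′ , v≈ , redᵛ ← reducible p
     | w′ , w≈ , redʷ ← reducible q
  = ≈-trans v≈ (≈-trans (reduced-≈ redᵛ redʷ
      (≡.trans (sym (≈-length v≈)) ∣v∣) (≡.trans (sym (≈-length w≈)) ∣w∣)
      (WeakOrder⇒0∈ (WeakOrder-resp-≈ v≈ p)) (WeakOrder⇒0∈ (WeakOrder-resp-≈ w≈ q))
      (≡.trans (sym (≈-sum v≈)) (≡.trans eq (≈-sum w≈)))) (≈-sym w≈))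
  where
  reduced-≈ : ∀ {v w} → Reduced v → Reduced w → length v ≡ suc n → length w ≡ suc n →
              0 ∈ v → 0 ∈ w → sum v ≡ sum w → v ≈ w
  reduced-≈ (binary a) (binary b) ∣v∣ ∣w∣ _ _ eq =
    permute (binary-↭ a b (≡.trans ∣v∣ (sym ∣w∣)) eq)
  reduced-≈ (binary a) (lifted u _) ∣v∣ ∣w∣ 0∈ _ eq =
    binary-lifted-≈ a 0∈ (≡.trans ∣v∣ (sym ∣w∣)) eq
  reduced-≈ (lifted u _) (binary b) ∣v∣ ∣w∣ _ 0∈ eq =
    ≈-sym (binary-lifted-≈ b 0∈ (≡.trans ∣w∣ (sym ∣v∣)) (sym eq))
  reduced-≈ (lifted u p) (lifted u′ q) ∣v∣ ∣w∣ _ _ eq =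
    lift-≈ (equalWeight⇒≈ n ∣u∣ ∣u′∣ p q
      (+-cancelˡ-≡ n (sum u) (sum u′)
        (≡.trans (cong (_+ sum u) (sym ∣u∣)) (≡.trans (sym (sum-map-suc u))
          (≡.trans eq (≡.trans (sum-map-suc u′) (cong (_+ sum u′) ∣u′∣)))))))
    where
    ∣u∣ : length u ≡ n
    ∣u∣ = ≡.trans (sym (length-map suc u)) (suc-injective ∣v∣)
    ∣u′∣ : length u′ ≡ n
    ∣u′∣ = ≡.trans (sym (length-map suc u′)) (suc-injective ∣w∣)

-- Cyclic shifts of a word.

turn : List A → List A
turn []       = []
turn (x ∷ xs) = xs ∷ʳ x

turn-++ : (xs ys : List A) → iterate turn (xs ++ ys) (length xs) ≡ ys ++ xs
turn-++ []       ys = sym (++-identityʳ ys)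
turn-++ (x ∷ xs) ys = begin
  iterate turn ((xs ++ ys) ∷ʳ x) (length xs)
    ≡⟨ cong (λ w → iterate turn w (length xs)) (++-assoc xs ys [ x ]) ⟩
  iterate turn (xs ++ ys ∷ʳ x) (length xs)  ≡⟨ turn-++ xs (ys ∷ʳ x) ⟩
  (ys ∷ʳ x) ++ xs                           ≡⟨ ++-assoc ys [ x ] xs ⟩
  ys ++ x ∷ xs                              ∎
  where open ≡-Reasoning

turn-↭ : (xs : List A) → turn xs ↭ xs
turn-↭ []       = refl
turn-↭ (x ∷ xs) = ++-comm xs [ x ]

iterate-turn-↭ : (i : ℕ) (xs : List A) → iterate turn xs i ↭ xs
iterate-turn-↭ zero    xs = refl
iterate-turn-↭ (suc i) xs = ↭-trans (iterate-turn-↭ i (turn xs)) (turn-↭ xs)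

iterate-turn-* : (i : ℕ) (xs : List A) → iterate turn xs (i * length xs) ≡ xs
iterate-turn-* zero    xs = refl
iterate-turn-* (suc i) xs = begin
  iterate turn xs (length xs + i * length xs)              ≡⟨ iterate-+ turn xs (length xs) _ ⟩
  iterate turn (iterate turn xs (length xs)) (i * length xs)
    ≡⟨ cong (λ w → iterate turn w (i * length xs)) full ⟩
  iterate turn xs (i * length xs)                          ≡⟨ iterate-turn-* i xs ⟩
  xs                                                       ∎
  where
  open ≡-Reasoning
  full : iterate turn xs (length xs) ≡ xs
  full = ≡.trans (cong (λ w → iterate turn w (length xs)) (sym (++-identityʳ xs)))
                 (turn-++ xs [])

take-length-++ : (xs ys : List A) → take (length xs) (xs ++ ys) ≡ xs
take-length-++ []       ys = refl
take-length-++ (x ∷ xs) ys = cong (x ∷_) (take-length-++ xs ys)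

-- a is an inverse of 1 + m modulo 1 + m + s, where 1 + m ≡ - s.
inverse-mod : ∀ m s → gcd s (1 + m + s) ≡ 1 →
              ∃[ a ] ∃[ b ] ∃[ c ] 1 + b * (1 + m + s) ≡ a * (1 + m) + c * (1 + m + s)
inverse-mod m s coprime
  with Bézout.identity (subst (GCD s (1 + m + s)) coprime (gcd-GCD s (1 + m + s)))
-- Here `1 + x * s` is a multiple of the modulus, so `x` inverts - s and is the inverse sought.
... | Bézout.-+ x y eq = x , x , y , (begin
  1 + x * (1 + m + s)               ≡⟨ expand x m s ⟩
  x * (1 + m) + (1 + x * s)         ≡⟨ cong (x * (1 + m) +_) eq ⟩
  x * (1 + m) + y * (1 + m + s)     ∎)
  where
  open ≡-Reasoning
  expand : ∀ x m s → 1 + x * (1 + m + s) ≡ x * (1 + m) + (1 + x * s)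
  expand = solve-∀
-- Here `x` inverts `s`, so - x is wanted; `x * (m + s)` represents it, as `m + s` is -1 modulo
-- `1 + m + s`.
... | Bézout.+- x y eq = x * (m + s) , y + x * (1 + m) , x , (begin
  1 + (y + x * (1 + m)) * (1 + m + s)                   ≡⟨ expand x y m s ⟩
  1 + y * (1 + m + s) + x * (1 + m) * (1 + m + s)       ≡⟨ cong (_+ x * (1 + m) * (1 + m + s)) eq ⟩
  x * s + x * (1 + m) * (1 + m + s)                     ≡⟨ collect x m s ⟩
  x * (m + s) * (1 + m) + x * (1 + m + s)               ∎)
  where
  open ≡-Reasoning
  expand : ∀ x y m s → 1 + (y + x * (1 + m)) * (1 + m + s) ≡
                       1 + y * (1 + m + s) + x * (1 + m) * (1 + m + s)
  expand = solve-∀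
  collect : ∀ x m s → x * s + x * (1 + m) * (1 + m + s) ≡
                      x * (m + s) * (1 + m) + x * (1 + m + s)
  collect = solve-∀

-- Finite enumeration, and passage between lists and vectors.

words : ℕ → List ℕ → List (List ℕ)
words zero    xs = [ [] ]
words (suc n) xs = cartesianProductWith _∷_ xs (words n xs)

∈-words : ∀ {xs w} → All (_∈ xs) w → w ∈ words (length w) xs
∈-words []       = here refl
∈-words (p ∷ ps) = ∈-cartesianProductWith⁺ _∷_ p (∈-words ps)

-- The quantifier over all numbers splits into two finite checks, one over the letters of `w` and
-- one over the numbers below `suc h`.
LettersUpTo? : ∀ h w → Dec (LettersUpTo h w)
LettersUpTo? h w = map′
  (λ (bounded , present) x → mk⇔ (All.lookup bounded) λ x≤h → present (s≤s x≤h))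
  (λ letters → LettersUpTo⇒All letters , λ {x} x<1+h → from (letters x) (s≤s⁻¹ x<1+h))
  (All.all? (_≤? h) w ×-dec allUpTo? (_∈? w) (suc h))

WeakOrder? : Decidable WeakOrder
WeakOrder? w = anyUpTo? (λ h → LettersUpTo? h w) (length w)

fromLists : ∀ {n} (ws : List (List A)) → (∀ {w} → w ∈ ws → length w ≡ n) →
            ∃[ vs ] map (toList {n = n}) vs ≡ ws
fromLists []       _   = [] , refl
fromLists (w ∷ ws) len with vs , refl ← fromLists ws (len ∘ there) | refl ← len (here refl) =
  fromList w ∷ vs , cong (_∷ map toList vs) (Vec.toList∘fromList w)

toList-injective : ∀ {n} {v w : Vec A n} → toList v ≡ toList w → v ≡ w
toList-injective {v = v} {w} eq =
  ≡.trans (sym (Vec.cast-is-id refl v)) (Vec.toList-injective refl v w eq)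

sum-toList : ∀ {n} (v : Vec ℕ n) → sum (toList v) ≡ Vec.sum v
sum-toList Vec.[]      = refl
sum-toList (x Vec.∷ v) = cong (x +_) (sum-toList v)

-- The overlap cycle for weak orders of given weight.

module _ (m s k : ℕ) (coprime : gcd s (2 + m + s) ≡ 1) where

  private
    n : ℕ
    n = 2 + m + s

  P : List ℕ → Set
  P w = length w ≡ n × WeakOrder w × sum w ≡ k

  P? : Decidable P
  P? w = (length w ≟ n) ×-dec WeakOrder? w ×-dec (sum w ≟ k)

  P-resp-↭ : ∀ {v w} → v ↭ w → P v → P w
  P-resp-↭ p (len , wo , eq) =
    ≡.trans (sym (↭-length p)) len , WeakOrder-resp-↭ p wo , ≡.trans (sym (sum-↭ p)) eq

  -- As `n` is `2 + m + s`, moving the first `2 + m` letters to the back is moving the last `s` to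
  -- the front.
  r : List ℕ → List ℕ
  r w = iterate turn w (2 + m)

  P-r : ∀ {w} → P w → P (r w)
  P-r {w} = P-resp-↭ (↭-sym (iterate-turn-↭ (2 + m) w))

  iterate-turn-*n : ∀ i {w} → P w → iterate turn w (i * n) ≡ w
  iterate-turn-*n i {w} (len , _) =
    subst (λ l → iterate turn w (i * l) ≡ w) len (iterate-turn-* i w)

  r-periodic : ∀ {w} → P w → iterate r w n ≡ w
  r-periodic {w} p = ≡.trans (iterate-* turn (2 + m) w n)
    (≡.trans (cong (iterate turn w) (*-comm n (2 + m))) (iterate-turn-*n (2 + m) p))

  suf≡pre∘r : ∀ {w} → P w → drop (2 + m) w ≡ take s (r w)
  suf≡pre∘r {w} (len , _) = sym (begin
    take s (r w) ≡⟨ cong (take s) rw ⟩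
    take s (b ++ a) ≡⟨ cong (λ i → take i (b ++ a)) ∣b∣ ⟨
    take (length b) (b ++ a) ≡⟨ take-length-++ b a ⟩
    b ∎)
    where
    open ≡-Reasoning
    a b : List ℕ
    a = take (2 + m) w
    b = drop (2 + m) w
    ∣a∣ : length a ≡ 2 + m
    ∣a∣ = ≡.trans (length-take (2 + m) w)
      (m≤n⇒m⊓n≡m (subst (2 + m ≤_) (sym len) (m≤m+n (2 + m) s)))
    ∣b∣ : length b ≡ s
    ∣b∣ = ≡.trans (length-drop (2 + m) w) (≡.trans (cong (_∸ (2 + m)) len) (m+n∸m≡n (2 + m) s))
    rw : r w ≡ b ++ a
    rw = begin
      iterate turn w (2 + m) ≡⟨ cong (λ v → iterate turn v (2 + m)) (take++drop≡id (2 + m) w) ⟨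
      iterate turn (a ++ b) (2 + m) ≡⟨ cong (iterate turn (a ++ b)) ∣a∣ ⟨
      iterate turn (a ++ b) (length a) ≡⟨ turn-++ a b ⟩
      b ++ a ∎

  open Gluing (≡-dec _≟_) P r P-r (1 + m + s) r-periodic (take s) (drop (2 + m)) suf≡pre∘r

  rotates : ∀ i {w} → Star Step w (iterate r w i)
  rotates zero    = ε
  rotates (suc i) = rotate ◅ rotates i

  -- Turns count modulo `n`, and `a` rotations of `2 + m` turns each amount to one turn modulo `n`.
  turn-connected : ∀ {w} → P w → Star Step w (turn w)
  turn-connected {w} p with a , b , c , eq ← inverse-mod (1 + m) s coprime =
    subst (Star Step w) (sym turn≡) (rotates a)
    where
    open ≡-Reasoning
    turn≡ : turn w ≡ iterate r w a
    turn≡ = begin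
      turn w                              ≡⟨ iterate-turn-*n b (P-resp-↭ (↭-sym (turn-↭ w)) p) ⟨
      iterate turn w (1 + b * n)          ≡⟨ cong (iterate turn w) eq ⟩
      iterate turn w (a * (2 + m) + c * n) ≡⟨ iterate-+ turn w (a * (2 + m)) (c * n) ⟩
      iterate turn (iterate turn w (a * (2 + m))) (c * n)
        ≡⟨ iterate-turn-*n c (P-resp-↭ (↭-sym (iterate-turn-↭ (a * (2 + m)) w)) p) ⟩
      iterate turn w (a * (2 + m))        ≡⟨ iterate-* turn (2 + m) w a ⟨
      iterate r w a                       ∎

  turns-connected : ∀ i {w} → P w → Star Step w (iterate turn w i)
  turns-connected zero    p = ε
  turns-connected (suc i) {w} p =
    turn-connected p ◅◅ turns-connected i (P-resp-↭ (↭-sym (turn-↭ w)) p)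

  ++-comm-connected : ∀ xs ys → P (xs ++ ys) → Star Step (xs ++ ys) (ys ++ xs)
  ++-comm-connected xs ys p =
    subst (Star Step (xs ++ ys)) (turn-++ xs ys) (turns-connected (length xs) p)

  exchange-connected : ∀ {x y x′ y′ t} → P (x′ ∷ y′ ∷ t) →
                       Star Step (x ∷ y ∷ t) (x′ ∷ y′ ∷ t)
  -- The words agree from the third letter on, so dropping `2 + m` letters gives the same result by
  -- computation.
  exchange-connected p = Step.exchange p refl ◅ ε

  -- Turn the two letters to the front, where they may be exchanged, and turn back.
  swap-connected : ∀ as x y {t} → P (as ++ x ∷ y ∷ t) →
                   Star Step (as ++ x ∷ y ∷ t) (as ++ y ∷ x ∷ t)
  swap-connected as x y {t} p =
    ++-comm-connected as (x ∷ y ∷ t) p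
    ◅◅ exchange-connected q
    ◅◅ ++-comm-connected (y ∷ x ∷ t) as q
    where
    q : P (y ∷ x ∷ t ++ as)
    q = P-resp-↭ (↭-trans (++-comm as (x ∷ y ∷ t)) (swap x y refl)) p

  -- The fixed prefix `as` lets the induction pass under a leading letter, which then joins the
  -- prefix.
  ↭-connected : ∀ as {xs ys} → P (as ++ xs) → xs ↭ ys → Star Step (as ++ xs) (as ++ ys)
  ↭-connected as p refl        = ε
  ↭-connected as {x ∷ xs} {_ ∷ ys} p (prep x q) =
    subst₂ (Star Step) (++-assoc as [ x ] xs) (++-assoc as [ x ] ys)
      (↭-connected (as ∷ʳ x) (subst P (sym (++-assoc as [ x ] xs)) p) q)
  ↭-connected as {x ∷ y ∷ xs} {_ ∷ _ ∷ ys} p (swap x y q) =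
    swap-connected as x y p
    ◅◅ subst₂ (Star Step) (++-assoc as (y ∷ [ x ]) xs) (++-assoc as (y ∷ [ x ]) ys)
      (↭-connected (as ++ y ∷ [ x ])
        (subst P (sym (++-assoc as (y ∷ [ x ]) xs)) (P-resp-↭ (++⁺ˡ as (swap x y refl)) p)) q)
  ↭-connected as p (trans q q′) =
    ↭-connected as p q ◅◅ ↭-connected as (P-resp-↭ (++⁺ˡ as q) p) q′

  P-resp-≈ : ∀ {v w} → v ≈ w → P v → P w
  P-resp-≈ q (len , wo , eq) =
    ≡.trans (sym (≈-length q)) len , WeakOrder-resp-≈ q wo , ≡.trans (sym (≈-sum q)) eq

  ≈-connected : ∀ {v w} → P v → v ≈ w → Star Step v w
  ≈-connected p (permute q)           = ↭-connected [] p q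
  ≈-connected p q@(exchange _ _ _)    = exchange-connected (P-resp-≈ q p)
  ≈-connected p (≈-trans q q′)        = ≈-connected p q ◅◅ ≈-connected (P-resp-≈ q p) q′

  connected : ∀ {v w} → P v → P w → Star Step v w
  connected p@(∣v∣ , wo , eq) (∣w∣ , wo′ , eq′) =
    ≈-connected p (equalWeight⇒≈ n ∣v∣ ∣w∣ wo wo′ (≡.trans eq (sym eq′)))

  P⇔𝓦 : (w : Vec ℕ n) → P (toList w) ⇔ 𝓦 k n w
  P⇔𝓦 w = mk⇔
    (λ { (_ , (h , h< , letters) , eq) →
        (h , subst (h <_) (Vec.length-toList w) h< , λ x →
          mk⇔ (to (letters x) ∘ ∈-toList⁺) (∈-toList⁻ ∘ from (letters x)))
      , ≡.trans (sym (sum-toList w)) eq })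
    (λ { ((h , h< , letters) , eq) →
        Vec.length-toList w
      , (h , subst (h <_) (sym (Vec.length-toList w)) h< , λ x →
          mk⇔ (to (letters x) ∘ ∈-toList⁻) (∈-toList⁺ ∘ from (letters x)))
      , ≡.trans (sum-toList w) eq })

  -- A weak order of length `n` has all letters below `n`, so testing finitely many words finds them
  -- all.
  candidates : List (List ℕ)
  candidates = filter P? (words n (upTo n))

  ∈-candidates : ∀ {w} → P w → w ∈ candidates
  ∈-candidates {w} p@(len , (h , h< , letters) , _) = ∈-filter⁺ P?
    (subst (λ i → w ∈ words i (upTo n)) len
      (∈-words (All.map (λ x≤h → ∈-upTo⁺ (≤-<-trans x≤h (subst (h <_) len h<)))
                        (LettersUpTo⇒All letters)))) p

  overlapCycle : HasOverlapCycle s (𝓦 k n)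
  overlapCycle
    with ws , (c , linked) , all∈ ←
           coveringCycle candidates (proj₂ ∘ ∈-filter⁻ P? {xs = words n (upTo n)}) connected
    with vs , refl ← fromLists {n = n} ws (proj₁ ∘ Closed.sound c)
    = vs , record
    { unique   = Unique.map⁻ (Closed.unique c)
    ; lists    = λ w → mk⇔
        (λ w∈ → to (P⇔𝓦 w) (Closed.sound c (∈-map⁺ toList w∈)))
        (λ w∈ → let v , v∈ , eq = ∈-map⁻ toList (all∈ (∈-candidates (from (P⇔𝓦 w) w∈)))
                in subst (_∈ vs) (sym (toList-injective eq)) v∈)
    ; overlaps = overlaps vs linked
    }
    where
    overlaps : ∀ vs → CyclicallyLinked R (map toList vs) →
               CyclicallyLinked (Overlap s) vs
    overlaps []       _      = _
    overlaps (v ∷ vs) linked = Linked.map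
      -- `Overlap` drops `n ∸ s` letters, which equals `2 + m`.
      (λ {u} → ≡.trans (cong (λ i → drop i (toList u)) (m+n∸n≡m (2 + m) s)))
      (Linked.map⁻ (subst (Linked R) (sym (map-++ toList (v ∷ vs) [ v ])) linked))

theorem4p3 : (n s k : ℕ) → 1 ≤ n → 1 ≤ s → 1 ≤ k → s + 2 ≤ n → k ≤ n C 2 →
    gcd s n ≡ 1 → HasOverlapCycle s (𝓦 k n)
theorem4p3 n s k _ _ _ s+2≤n _ coprime =
  subst (λ i → HasOverlapCycle s (𝓦 k i)) n≡
    -- `n ∸ (s + 2)` counts the free letters beyond the two that exchanges need.
    (overlapCycle (n ∸ (s + 2)) s k (subst (λ i → gcd s i ≡ 1) (sym n≡) coprime))
  where
  open ≡-Reasoning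
  n≡ : 2 + (n ∸ (s + 2)) + s ≡ n
  n≡ = begin
    2 + (n ∸ (s + 2)) + s   ≡⟨ rearrange (n ∸ (s + 2)) s ⟩
    n ∸ (s + 2) + (s + 2)   ≡⟨ m∸n+n≡m s+2≤n ⟩
    n                       ∎
    where
    rearrange : ∀ m s → 2 + m + s ≡ m + (s + 2)
    rearrange = solve-∀
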